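{- For every integer $k \ge 1$, the edge set of the hypercube $Q_{2k}$ can be partitioned into the edge sets of $k$ pairwise edge-disjoint spanning trees of $Q_{2k}$ together with a matching consisting of exactly $k$ edges.
   Context: The $n$-dimensional hypercube $Q_n$ is the graph whose vertices are all binary vectors of length $n$, with two vertices adjacent if and only if they differ in exactly one coordinate. A matching is a set of pairwise vertex-disjoint edges. -}

module Defs where

open import Data.Bool.Base using (Bool)
open import Data.Fin.Base using (Fin)
open import Data.List.Base using (List; _∷_; _∷ʳ_; length)
open import Data.List.Relation.Unary.Linked using (Linked)
open import Data.List.Relation.Unary.Unique.Propositional using (Unique)
open import Data.Nat.Base using (ℕ; _≤_)
open import Data.Product.Base using (_×_; _,_; ∃-syntax; proj₁; proj₂; swap)
open import Data.Product using (∃!)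
open import Data.Sum.Base using (_⊎_; inj₁; inj₂)
open import Data.Vec.Base using (Vec; lookup)
open import Function.Bundles using (Bijection)
open import Level using (0ℓ)
open import Relation.Binary.Bundles using (Setoid)
open import Relation.Binary.Construct.Closure.ReflexiveTransitive using (Star)
open import Relation.Binary.Core using (Rel; _⇒_)
open import Relation.Binary.Definitions using (Symmetric; Irreflexive)
open import Relation.Binary.PropositionalEquality
  using (_≡_; _≢_; refl; sym; trans; cong; setoid)
open import Relation.Nullary.Negation.Core using (¬_)

-- Simple graphs on a fixed vertex type.  A set of edges between vertices of V
-- (such as a matching) is represented by the graph on V having these edges.
record Graph (V : Set) : Set₁ where
  field
    Adj    : Rel V 0ℓ
    symm   : Symmetric Adj
    irrefl : Irreflexive _≡_ Adj

open Graph public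

module _ {V : Set} where

  record Edge (G : Graph V) : Set where
    constructor edge
    field
      ends : V × V
      adj  : Adj G (proj₁ ends) (proj₂ ends)

  open Edge public

  -- Edges are unordered: the two orientations of an edge, and different
  -- proofs of adjacency, are identified.
  _≈ₑ_ : {G : Graph V} → Rel (Edge G) 0ℓ
  e ≈ₑ f = ends e ≡ ends f ⊎ ends e ≡ swap (ends f)

  edgeSetoid : Graph V → Setoid 0ℓ 0ℓ
  edgeSetoid G = record
    { Carrier       = Edge G
    ; _≈_           = _≈ₑ_
    ; isEquivalence = record
      { refl  = inj₁ refl
      ; sym   = λ where
          (inj₁ p) → inj₁ (sym p)
          (inj₂ p) → inj₂ (sym (cong swap p))
      ; trans = λ where
          (inj₁ p) (inj₁ q) → inj₁ (trans p q)
          (inj₁ p) (inj₂ q) → inj₂ (trans p q)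
          (inj₂ p) (inj₁ q) → inj₂ (trans p (cong swap q))
          (inj₂ p) (inj₂ q) → inj₁ (trans p (cong swap q))
      }
    }

  HasEdgeCount : Graph V → ℕ → Set
  HasEdgeCount G m = Bijection (setoid (Fin m)) (edgeSetoid G)

  _∈ₑ_ : {G : Graph V} → V → Edge G → Set
  x ∈ₑ e = x ≡ proj₁ (ends e) ⊎ x ≡ proj₂ (ends e)

  _⊆ₑ_ : Graph V → Graph V → Set
  H ⊆ₑ G = Adj H ⇒ Adj G

  EdgeDisjoint : Graph V → Graph V → Set
  EdgeDisjoint G H = ∀ {u v} → ¬ (Adj G u v × Adj H u v)

  Connected : Graph V → Set
  Connected G = ∀ u v → Star (Adj G) u v

  -- x ∷ vs lists the (at least three) distinct vertices of a cycle in order.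
  IsCycle : Graph V → V → List V → Set
  IsCycle G x vs =
    2 ≤ length vs × Unique (x ∷ vs) × Linked (Adj G) (x ∷ (vs ∷ʳ x))

  Acyclic : Graph V → Set
  Acyclic G = ∀ x vs → ¬ IsCycle G x vs

  IsTree : Graph V → Set
  IsTree G = Connected G × Acyclic G

  -- A subgraph represented on the same vertex type V is automatically spanning.
  IsSpanningTree : Graph V → Graph V → Set
  IsSpanningTree G T = T ⊆ₑ G × IsTree T

  IsMatching : Graph V → Graph V → Set
  IsMatching G M =
    M ⊆ₑ G × ((e f : Edge M) → ¬ (e ≈ₑ f) → ∀ x → ¬ (x ∈ₑ e × x ∈ₑ f))

  IsEdgePartition : {I : Set} → Graph V → (I → Graph V) → Set
  IsEdgePartition G P =
    (∀ i → P i ⊆ₑ G) ×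
    (∀ i j → i ≢ j → EdgeDisjoint (P i) (P j)) ×
    (∀ {u v} → Adj G u v → ∃[ i ] Adj (P i) u v)

Q : (n : ℕ) → Graph (Vec Bool n)
Q n = record
  { Adj    = λ u v → ∃! _≡_ λ i → lookup u i ≢ lookup v i
  ; symm   = λ (i , u≢v , uniq) →
      i , (λ eq → u≢v (sym eq)) , λ v≢u → uniq (λ eq → v≢u (sym eq))
  ; irrefl = λ { refl (_ , u≢u , _) → u≢u refl }
  }

{-# OPTIONS --safe #-}

-- The decomposition is encoded by maps p₁, …, p_k on the vertices such that
-- every edge is {x , pᵢ x} for exactly one pair (i , x).  Each pᵢ decreases a
-- rank except at one vertex rᵢ: the arcs of pᵢ leaving the other vertices form a
-- spanning tree, and the k arcs from rᵢ to its "mate" pᵢ rᵢ form the matching.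
--
-- For the step, view Q_{n+2} as Q_n □ C₄.  Orienting every C₄ cyclically adds a
-- (k+1)-st map to the copies of p₁, …, p_k, and permuting these k + 1 maps
-- independently at each vertex keeps every edge used exactly once.  Suitable
-- permutations turn p₁ and the cyclic map into two trees with roots above r₁.
-- Every other pᵢ becomes one tree: above rᵢ it receives a path of C₄, and three
-- copies of the edge rᵢ – pᵢ rᵢ serve as replacements for that path.  This needs
-- the mate of rᵢ to precede rᵢ in the rank of the first tree, so the induction
-- carries this condition along.
module Submission where

open import Defs
open import Data.Bool.Base using (Bool; true; false; if_then_else_)
import Data.Bool.Properties as Bool
open import Data.Empty using (⊥)
open import Data.Fin.Base using (Fin; zero; suc)
open import Data.Fin.Patterns using (0F)
import Data.Fin.Properties as Fin
open import Data.Fin.Permutation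
  using (Permutation′; permutation; _⟨$⟩ʳ_; _⟨$⟩ˡ_; inverseˡ; inverseʳ; swap)
  renaming (id to idₚ)
open import Data.List.Base using ([]; _∷_; _∷ʳ_)
open import Data.List.Membership.Propositional using (_∈_)
open import Data.List.Membership.Propositional.Properties using (∈-++⁺ʳ)
open import Data.List.Relation.Unary.All using (All; []; _∷_)
import Data.List.Relation.Unary.All as All
open import Data.List.Relation.Unary.AllPairs using ([]; _∷_)
open import Data.List.Relation.Unary.Any using (here; there)
open import Data.List.Relation.Unary.Linked using (Linked; _∷_)
open import Data.List.Relation.Unary.Unique.Propositional using (Unique)
open import Data.List.Relation.Unary.Unique.Propositional.Properties using (++⁺)
open import Data.Nat.Base using (ℕ; zero; suc; _+_; _*_; _≤_; _<_; _≥_; z≤n; s≤s)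
open import Data.Nat.Induction using (<-wellFounded)
open import Data.Nat.Properties
  using (<-irrefl; <-asym; <-trans; ≤-refl; m≤m+n; m≤n+m; +-identityʳ; +-mono-<-≤; *-suc)
open import Data.Product.Base using (Σ-syntax; ∃-syntax; _×_; _,_; proj₁; proj₂)
open import Data.Sum.Base using (_⊎_; inj₁; inj₂; [_,_])
open import Data.Unit.Base using (⊤; tt)
open import Data.Vec.Base using (Vec; []; _∷_; lookup)
open import Data.Vec.Properties using (≡-dec)
open import Data.Vec.Relation.Binary.Pointwise.Extensional using (ext; Pointwise-≡⇒≡)
open import Function.Base using (_∘_)
open import Induction.WellFounded using (Acc; acc)
open import Relation.Binary.Bundles using (Setoid)
open import Relation.Binary.Construct.Closure.ReflexiveTransitive
  using (Star; ε; _◅_; _◅◅_; reverse)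
open import Relation.Binary.Definitions using (DecidableEquality)
open import Relation.Binary.PropositionalEquality
  using (_≡_; _≢_; refl; sym; trans; cong; subst)
open import Relation.Nullary using (yes; no; does)
open import Relation.Nullary.Negation using (contradiction)

-- Trees given by parent maps

module ParentMap {V : Set} (_≟_ : DecidableEquality V)
                 (p : V → V) (r : V) (rank : V → ℕ)
                 (descends : ∀ {x} → x ≢ r → rank (p x) < rank x) where

  infix 4 _⇧_

  -- The arc leaving `r` is left out: it is reserved for the matching, and `p r` may be any vertex.
  _⇧_ : V → V → Set
  x ⇧ y = x ≢ r × p x ≡ y

  ⇧⇒> : ∀ {x y} → x ⇧ y → rank y < rank x
  ⇧⇒> (x≢r , refl) = descends x≢r

  tree : Graph V
  tree = record
    { Adj    = λ x y → x ⇧ y ⊎ y ⇧ x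
    ; symm   = [ inj₂ , inj₁ ]
    ; irrefl = λ { refl (inj₁ u) → <-irrefl refl (⇧⇒> u)
                 ; refl (inj₂ u) → <-irrefl refl (⇧⇒> u) }
    }

  toRoot : ∀ x → Acc _<_ (rank x) → Star (Adj tree) x r
  toRoot x (acc rec) with x ≟ r
  ... | yes refl = ε
  ... | no x≢r   = inj₁ (x≢r , refl) ◅ toRoot (p x) (rec (descends x≢r))

  connected : Connected tree
  connected x y =
    toRoot x (<-wellFounded _) ◅◅ reverse (symm tree) (toRoot y (<-wellFounded _))

  -- A simple path whose first step leads away from the root never turns back.
  climb-rank : ∀ {a b l} → Linked (Adj tree) (a ∷ b ∷ l) → Unique (a ∷ b ∷ l) →
               b ⇧ a → All (λ z → rank a < rank z) (b ∷ l)
  climb-rank {l = []} _ _ b⇧a = ⇧⇒> b⇧a ∷ []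
  climb-rank {l = c ∷ l} (_ ∷ inj₁ (_ , refl) ∷ _) ((_ ∷ a≢c ∷ _) ∷ _) (_ , refl) =
    contradiction refl a≢c
  climb-rank {l = c ∷ l} (_ ∷ path@(inj₂ c⇧b ∷ _)) (_ ∷ uniq) b⇧a =
    ⇧⇒> b⇧a ∷ All.map (<-trans (⇧⇒> b⇧a)) (climb-rank path uniq c⇧b)

  climb-end : ∀ {a b z} l → Linked (Adj tree) (a ∷ b ∷ l ∷ʳ z) → Unique (a ∷ b ∷ l ∷ʳ z) →
              b ⇧ a → p z ∈ b ∷ l
  climb-end [] (_ ∷ inj₁ (_ , refl) ∷ _) ((_ ∷ a≢z ∷ _) ∷ _) (_ , refl) =
    contradiction refl a≢z
  climb-end [] (_ ∷ inj₂ (_ , pz≡b) ∷ _) _ _ = here pz≡b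
  climb-end (c ∷ l) (_ ∷ inj₁ (_ , refl) ∷ _) ((_ ∷ a≢c ∷ _) ∷ _) (_ , refl) =
    contradiction refl a≢c
  climb-end (c ∷ l) (_ ∷ path@(inj₂ c⇧b ∷ _)) (_ ∷ uniq) _ =
    there (climb-end l path uniq c⇧b)

  -- A step climbs if it leads away from the root. A simple path that never climbs ends at a smaller
  -- rank; one that climbs once must climb until its end, so it enters `z` from `p z`.
  path-end : ∀ {a b z} l → Linked (Adj tree) (a ∷ b ∷ l ∷ʳ z) → Unique (a ∷ b ∷ l ∷ʳ z) →
             rank z < rank a ⊎ p z ∈ b ∷ l
  path-end l path@(inj₂ b⇧a ∷ _) uniq = inj₂ (climb-end l path uniq b⇧a)
  path-end [] (inj₁ a⇧b ∷ inj₁ b⇧z ∷ _) _ = inj₁ (<-trans (⇧⇒> b⇧z) (⇧⇒> a⇧b))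
  path-end [] (inj₁ _ ∷ inj₂ (_ , pz≡b) ∷ _) _ = inj₂ (here pz≡b)
  path-end (c ∷ l) (inj₁ a⇧b ∷ path) (_ ∷ uniq) with path-end l path uniq
  ... | inj₁ z<b   = inj₁ (<-trans z<b (⇧⇒> a⇧b))
  ... | inj₂ pz∈cl = inj₂ (there pz∈cl)

  -- If the first edge of a cycle climbs from `x`, the cycle climbs all the way back to `x`, which
  -- is absurd for ranks. If it leads to `p x`, the rest must return to `x` either by descending
  -- only, against the ranks, or through `p x` a second time.
  acyclic : Acyclic tree
  acyclic x [] (() , _)
  acyclic x (v ∷ []) (s≤s () , _)
  acyclic x (v ∷ w ∷ l) (_ , x∉vs@(_ ∷ x≢w ∷ _) ∷ uniq@(v∉ ∷ _) , xv ∷ path@(vw ∷ _)) = split xv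
    where
    uniq′ : Unique (v ∷ w ∷ l ∷ʳ x)
    uniq′ = ++⁺ uniq ([] ∷ []) λ { (z∈vs , here refl) → All.lookup x∉vs z∈vs refl }

    away : v ⇧ x → Adj tree v w → ⊥
    away (_ , refl) (inj₁ (_ , refl)) = x≢w refl
    away v⇧x (inj₂ w⇧v) =
      <-asym (⇧⇒> v⇧x) (All.lookup (climb-rank path uniq′ w⇧v) (there (∈-++⁺ʳ l (here refl))))

    split : Adj tree x v → ⊥
    split (inj₂ v⇧x) = away v⇧x vw
    split (inj₁ x⇧v@(_ , px≡v)) with path-end l path uniq′
    ... | inj₁ x<v = <-asym x<v (⇧⇒> x⇧v)
    ... | inj₂ px∈ = All.lookup v∉ px∈ (sym px≡v)

  isTree : IsTree tree
  isTree = connected , acyclic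

-- Adjacency in the hypercube

infix 4 _~_

-- An inductive form of adjacency in `Q`, which lets the edges of the product with C₄ be classified
-- by pattern matching.
data _~_ : ∀ {n} → Vec Bool n → Vec Bool n → Set where
  flip : ∀ {n b c} {x : Vec Bool n} → b ≢ c → b ∷ x ~ c ∷ x
  keep : ∀ {n b} {x y : Vec Bool n} → x ~ y → b ∷ x ~ b ∷ y

~⇒Q : ∀ {n} {x y : Vec Bool n} → x ~ y → Adj (Q n) x y
~⇒Q (flip b≢c) = zero , b≢c , λ
  { {zero}  _   → refl
  ; {suc i} x≢x → contradiction refl x≢x }
~⇒Q (keep x~y) with ~⇒Q x~y
... | i , xᵢ≢yᵢ , uniq = suc i , xᵢ≢yᵢ , λ
  { {zero}  b≢b → contradiction refl b≢b
  ; {suc j} ≢ⱼ  → cong suc (uniq ≢ⱼ) }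

Q⇒~ : ∀ {n} {x y : Vec Bool n} → Adj (Q n) x y → x ~ y
Q⇒~ {x = b ∷ x} {c ∷ y} (zero , b≢c , uniq) =
  subst (λ z → b ∷ x ~ c ∷ z) (Pointwise-≡⇒≡ (ext agree)) (flip b≢c)
  where
  agree : ∀ i → lookup x i ≡ lookup y i
  agree i with lookup x i Bool.≟ lookup y i
  ... | yes eq = eq
  ... | no neq with () ← uniq {suc i} neq
Q⇒~ {x = b ∷ x} {c ∷ y} (suc i , xᵢ≢yᵢ , uniq) with b Bool.≟ c
... | yes refl = keep (Q⇒~ (i , xᵢ≢yᵢ , λ ≢ⱼ → Fin.suc-injective (uniq ≢ⱼ)))
... | no b≢c with () ← uniq {zero} b≢c

_≟ᵛ_ : ∀ {n} → DecidableEquality (Vec Bool n)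
_≟ᵛ_ = ≡-dec Bool._≟_

-- Orientations of the hypercube, with the outgoing arcs at each vertex indexed by Fin k

record IsOrientation {n k} (p : Fin k → Vec Bool n → Vec Bool n) : Set where
  field
    sound : ∀ i x → x ~ p i x
    cover : ∀ {x y} → x ~ y → ∃[ i ] (p i x ≡ y ⊎ p i y ≡ x)
    -- No edge is used twice: `inj` excludes a second arc in the same direction, `anti` one in the
    -- opposite direction.
    inj   : ∀ {i j x} → p i x ≡ p j x → i ≡ j
    anti  : ∀ {i j x} → p j (p i x) ≢ x

permuteArcs : ∀ {n k} → (Vec Bool n → Permutation′ k) →
              (Fin k → Vec Bool n → Vec Bool n) → Fin k → Vec Bool n → Vec Bool n
permuteArcs π p i x = p (π x ⟨$⟩ʳ i) x

-- Relabelling the arcs that leave a vertex does not change the set of arcs, so the permutations at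
-- different vertices need not be related.
permuteArcs-isOrientation :
  ∀ {n k} (π : Vec Bool n → Permutation′ k) {p : Fin k → Vec Bool n → Vec Bool n} →
  IsOrientation p → IsOrientation (permuteArcs π p)
permuteArcs-isOrientation π {p} o = record
  { sound = λ i x → sound (π x ⟨$⟩ʳ i) x
  ; cover = λ x~y → relabel (cover x~y)
  ; inj   = λ {i} {j} {x} eq →
      trans (sym (inverseˡ (π x))) (trans (cong (π x ⟨$⟩ˡ_) (inj eq)) (inverseˡ (π x)))
  ; anti  = anti
  }
  where
  open IsOrientation o
  at-inverse : ∀ i x → permuteArcs π p (π x ⟨$⟩ˡ i) x ≡ p i x
  at-inverse i x = cong (λ j → p j x) (inverseʳ (π x))
  relabel : ∀ {x y} → ∃[ i ] (p i x ≡ y ⊎ p i y ≡ x) →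
            ∃[ i ] (permuteArcs π p i x ≡ y ⊎ permuteArcs π p i y ≡ x)
  relabel {x} (i , inj₁ eq) = π x ⟨$⟩ˡ i , inj₁ (trans (at-inverse i x) eq)
  relabel {y = y} (i , inj₂ eq) = π y ⟨$⟩ˡ i , inj₂ (trans (at-inverse i y) eq)

-- The four layers of Q_{n+2} = Q_n □ C₄, in cyclic order

Layer : Set
Layer = Bool × Bool

-- A Gray code: cyclically consecutive layers differ in one bit.
pattern L0 = false , false
pattern L1 = false , true
pattern L2 = true , true
pattern L3 = true , false

at : ∀ {n} → Layer → Vec Bool n → Vec Bool (2 + n)
at (b , c) x = b ∷ c ∷ x

at-injective : ∀ {n l m} {x y : Vec Bool n} → at l x ≡ at m y → l ≡ m × x ≡ y
at-injective refl = refl , refl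

pred : Layer → Layer
pred L0 = L3
pred L1 = L0
pred L2 = L1
pred L3 = L2

pred≢ : ∀ l → pred l ≢ l
pred≢ L0 ()
pred≢ L1 ()
pred≢ L2 ()
pred≢ L3 ()

-- This keeps one cyclic arc from being the reverse of another.
pred²≢ : ∀ l → pred (pred l) ≢ l
pred²≢ L0 ()
pred²≢ L1 ()
pred²≢ L2 ()
pred²≢ L3 ()

boxArcs : ∀ {n k} → (Fin k → Vec Bool n → Vec Bool n) →
          Fin (suc k) → Vec Bool (2 + n) → Vec Bool (2 + n)
boxArcs p zero    (b ∷ c ∷ x) = at (pred (b , c)) x
boxArcs p (suc i) (b ∷ c ∷ x) = at (b , c) (p i x)

boxArcs-isOrientation : ∀ {n k} {p : Fin k → Vec Bool n → Vec Bool n} →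
                        IsOrientation p → IsOrientation (boxArcs p)
boxArcs-isOrientation {p = p} o = record
  { sound = sound′ ; cover = cover′
  ; inj = λ {i} {j} {x} → inj′ i j x ; anti = λ {i} {j} {x} → anti′ i j x }
  where
  open IsOrientation o

  sound′ : ∀ i x → x ~ boxArcs p i x
  sound′ zero    (false ∷ false ∷ x) = flip λ ()
  sound′ zero    (false ∷ true  ∷ x) = keep (flip λ ())
  sound′ zero    (true  ∷ true  ∷ x) = flip λ ()
  sound′ zero    (true  ∷ false ∷ x) = keep (flip λ ())
  sound′ (suc i) (b ∷ c ∷ x)         = keep (keep (sound i x))

  cover′ : ∀ {x y} → x ~ y → ∃[ i ] (boxArcs p i x ≡ y ⊎ boxArcs p i y ≡ x)
  cover′ {false ∷ false ∷ _} {true  ∷ _} (flip _) = 0F , inj₁ refl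
  cover′ {false ∷ true  ∷ _} {true  ∷ _} (flip _) = 0F , inj₂ refl
  cover′ {true  ∷ false ∷ _} {false ∷ _} (flip _) = 0F , inj₂ refl
  cover′ {true  ∷ true  ∷ _} {false ∷ _} (flip _) = 0F , inj₁ refl
  cover′ {false ∷ _} {false ∷ _} (flip b≢b) = contradiction refl b≢b
  cover′ {true  ∷ _} {true  ∷ _} (flip b≢b) = contradiction refl b≢b
  cover′ {false ∷ false ∷ _} {_ ∷ true  ∷ _} (keep (flip _)) = 0F , inj₂ refl
  cover′ {false ∷ true  ∷ _} {_ ∷ false ∷ _} (keep (flip _)) = 0F , inj₁ refl
  cover′ {true  ∷ false ∷ _} {_ ∷ true  ∷ _} (keep (flip _)) = 0F , inj₁ refl
  cover′ {true  ∷ true  ∷ _} {_ ∷ false ∷ _} (keep (flip _)) = 0F , inj₂ refl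
  cover′ {_ ∷ false ∷ _} {_ ∷ false ∷ _} (keep (flip c≢c)) = contradiction refl c≢c
  cover′ {_ ∷ true  ∷ _} {_ ∷ true  ∷ _} (keep (flip c≢c)) = contradiction refl c≢c
  cover′ {b ∷ c ∷ _} (keep (keep x~y)) with cover x~y
  ... | i , inj₁ eq = suc i , inj₁ (cong (at (b , c)) eq)
  ... | i , inj₂ eq = suc i , inj₂ (cong (at (b , c)) eq)

  inj′ : ∀ i j x → boxArcs p i x ≡ boxArcs p j x → i ≡ j
  inj′ zero    zero    (b ∷ c ∷ x) _  = refl
  inj′ zero    (suc j) (b ∷ c ∷ x) eq =
    contradiction (proj₁ (at-injective eq)) (pred≢ (b , c))
  inj′ (suc i) zero    (b ∷ c ∷ x) eq =
    contradiction (sym (proj₁ (at-injective eq))) (pred≢ (b , c))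
  inj′ (suc i) (suc j) (b ∷ c ∷ x) eq = cong suc (inj (proj₂ (at-injective eq)))

  anti′ : ∀ i j x → boxArcs p j (boxArcs p i x) ≢ x
  anti′ zero    zero    (b ∷ c ∷ x) eq = pred²≢ (b , c) (proj₁ (at-injective eq))
  anti′ zero    (suc j) (b ∷ c ∷ x) eq = pred≢ (b , c) (proj₁ (at-injective eq))
  anti′ (suc i) zero    (b ∷ c ∷ x) eq = pred≢ (b , c) (proj₁ (at-injective eq))
  anti′ (suc i) (suc j) (b ∷ c ∷ x) eq = anti (proj₂ (at-injective eq))

-- The inductive decomposition

record Decomposition (n m : ℕ) : Set where
  field
    p             : Fin (suc m) → Vec Bool n → Vec Bool n
    isOrientation : IsOrientation p
    root          : Fin (suc m) → Vec Bool n
    rank          : Fin (suc m) → Vec Bool n → ℕ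
    descends      : ∀ i {x} → x ≢ root i → rank i (p i x) < rank i x

  mate : Fin (suc m) → Vec Bool n
  mate i = p i (root i)

  field
    -- The next three conditions make the edges from `root i` to `mate i` pairwise disjoint.
    root-injective : ∀ {i j} → root i ≡ root j → i ≡ j
    mate-injective : ∀ {i j} → mate i ≡ mate j → i ≡ j
    root≢mate      : ∀ i j → root i ≢ mate j
    mate<root      : ∀ i → rank zero (mate (suc i)) < rank zero (root (suc i))

-- `Q 2` is C₄ itself: its cyclic arcs form a path ending at `L0` and one closing edge from `L0` to
-- `L3`.
square : Decomposition 2 0
square = record
  { p              = boxArcs {k = 0} (λ ())
  ; isOrientation  = boxArcs-isOrientation empty
  ; root           = λ _ → at L0 []
  ; rank           = λ _ → height
  ; descends       = λ { zero {x} → descends x }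
  ; root-injective = λ { {zero} {zero} _ → refl }
  ; mate-injective = λ { {zero} {zero} _ → refl }
  ; root≢mate      = λ { zero zero () }
  ; mate<root      = λ ()
  }
  where
  empty : IsOrientation {n = 0} {k = 0} (λ ())
  empty = record { sound = λ () ; cover = λ () ; inj = λ { {()} } ; anti = λ { {()} } }

  height : Vec Bool 2 → ℕ
  height (false ∷ false ∷ []) = 0
  height (false ∷ true  ∷ []) = 1
  height (true  ∷ true  ∷ []) = 2
  height (true  ∷ false ∷ []) = 3

  descends : ∀ x → x ≢ at L0 [] → height (boxArcs (λ ()) zero x) < height x
  descends (false ∷ false ∷ []) x≢r = contradiction refl x≢r
  descends (false ∷ true  ∷ []) _   = ≤-refl
  descends (true  ∷ true  ∷ []) _   = ≤-refl
  descends (true  ∷ false ∷ []) _   = ≤-refl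

-- The 3-cycle sending `zero` to `suc zero`, then to `suc (suc i)`, then back to `zero`. It hands
-- the C₄ arc to the map `suc (suc i)` and pays the second tree with a copy of the arc of
-- `p (suc i)`.
cycleTo : ∀ {m} → Fin m → Permutation′ (2 + m)
cycleTo {m} i = permutation to from to∘from from∘to
  where
  to from : Fin (2 + m) → Fin (2 + m)
  to zero = suc zero
  to (suc zero) = suc (suc i)
  to (suc (suc j)) = if does (j Fin.≟ i) then zero else suc (suc j)
  from zero = suc (suc i)
  from (suc zero) = zero
  from (suc (suc j)) = if does (j Fin.≟ i) then suc zero else suc (suc j)

  to-i : to (suc (suc i)) ≡ zero
  to-i with i Fin.≟ i
  ... | yes _  = refl
  ... | no i≢i = contradiction refl i≢i

  from-i : from (suc (suc i)) ≡ suc zero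
  from-i with i Fin.≟ i
  ... | yes _  = refl
  ... | no i≢i = contradiction refl i≢i

  to∘from : ∀ j → to (from j) ≡ j
  to∘from zero = to-i
  to∘from (suc zero) = refl
  to∘from (suc (suc j)) with j Fin.≟ i in eq
  ... | yes refl = refl
  ... | no _ rewrite eq = refl

  from∘to : ∀ j → from (to j) ≡ j
  from∘to zero = refl
  from∘to (suc zero) = from-i
  from∘to (suc (suc j)) with j Fin.≟ i in eq
  ... | yes refl = refl
  ... | no _ rewrite eq = refl

-- The induction step, from `Q n` to `Q (2 + n)`

module Step {n m} (D : Decomposition n m) where
  open Decomposition D

  r₀ s₀ : Vec Bool n
  r₀ = root zero
  s₀ = mate zero

  -- The column above `x` is the copy of C₄ over it; its kind decides how its arcs are relabelled.
  -- The conditions on roots and mates make the four kinds exclusive.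
  data Kind (x : Vec Bool n) : Set where
    isRoot  : x ≡ r₀ → Kind x
    isMate  : x ≡ s₀ → Kind x
    special : ∀ i → x ≡ root (suc i) → Kind x
    normal  : x ≢ r₀ → x ≢ s₀ → (∀ i → x ≢ root (suc i)) → Kind x

  kind : ∀ x → Kind x
  kind x with x ≟ᵛ r₀ | x ≟ᵛ s₀ | Fin.any? (λ i → x ≟ᵛ root (suc i))
  ... | yes x≡r | _       | _            = isRoot x≡r
  ... | no _    | yes x≡s | _            = isMate x≡s
  ... | no _    | no _    | yes (i , eq) = special i eq
  ... | no x≢r  | no x≢s  | no ∄i        = normal x≢r x≢s (λ i eq → ∄i (i , eq))

  -- The label zero stands for the arc along C₄ and suc h for the copy of p h.
  -- Of the new maps, zero and suc zero replace the old map zero, and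
  -- suc (suc i) replaces suc i.
  perm : ∀ {x} → Kind x → Layer → Permutation′ (2 + m)
  perm (isRoot _)     L0 = swap idₚ
  perm (isRoot _)     _  = idₚ
  perm (isMate _)     L3 = idₚ
  perm (isMate _)     _  = swap idₚ
  perm (special _ _)  L3 = idₚ
  perm (special i _)  _  = cycleTo i
  perm (normal _ _ _) L0 = swap idₚ
  perm (normal _ _ _) L1 = idₚ
  perm (normal _ _ _) L2 = swap idₚ
  perm (normal _ _ _) L3 = idₚ

  permAt : Vec Bool (2 + n) → Permutation′ (2 + m)
  permAt (b ∷ c ∷ x) = perm (kind x) (b , c)

  p′ : Fin (2 + m) → Vec Bool (2 + n) → Vec Bool (2 + n)
  p′ = permuteArcs permAt (boxArcs p)

  old : Fin (2 + m) → Fin (suc m)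
  old zero    = zero
  old (suc i) = i

  -- The first two trees both have their roots above `r₀`; different layers keep their matching
  -- edges apart.
  rootLayer : Fin (2 + m) → Layer
  rootLayer zero    = L0
  rootLayer (suc _) = L3

  root′ : Fin (2 + m) → Vec Bool (2 + n)
  root′ i = at (rootLayer i) (root (old i))

  old-injective : ∀ {i j} → rootLayer i ≡ rootLayer j → old i ≡ old j → i ≡ j
  old-injective {zero}  {zero}  _ _    = refl
  old-injective {suc i} {suc j} _ refl = refl
  old-injective {zero}  {suc j} ()
  old-injective {suc i} {zero}  ()

  -- In layer 3 no column permutes its labels, so `p′ (suc j)` is the copy of `p j` there. For the
  -- first map, the swap at `L0` above `r₀` selects the copy of `p zero`.
  p′-root′ : ∀ i → p′ i (root′ i) ≡ at (rootLayer i) (mate (old i))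
  p′-root′ zero with kind r₀
  ... | isRoot _       = refl
  ... | isMate r≡s     = contradiction r≡s (root≢mate zero zero)
  ... | special i eq   with () ← root-injective eq
  ... | normal r≢r _ _ = contradiction refl r≢r
  p′-root′ (suc zero) with kind r₀
  ... | isRoot _       = refl
  ... | isMate _       = refl
  ... | special _ _    = refl
  ... | normal _ _ _   = refl
  p′-root′ (suc (suc i)) with kind (root (suc i))
  ... | isRoot _       = refl
  ... | isMate _       = refl
  ... | special _ _    = refl
  ... | normal _ _ _   = refl

  -- In the first tree layer 3 consists of leaves, so its rank at r₀ may be
  -- raised; this puts the new mate at L3 s₀ before the new root at L3 r₀.
  leafBonus : Vec Bool n → ℕ
  leafBonus x = if does (x ≟ᵛ r₀) then suc (rank zero s₀) else 0

  leafBonus-r₀ : leafBonus r₀ ≡ suc (rank zero s₀)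
  leafBonus-r₀ with r₀ ≟ᵛ r₀
  ... | yes _  = refl
  ... | no r≢r = contradiction refl r≢r

  leafBonus-≢ : ∀ {x} → x ≢ r₀ → leafBonus x ≡ 0
  leafBonus-≢ {x} x≢r with x ≟ᵛ r₀
  ... | yes x≡r = contradiction x≡r x≢r
  ... | no _    = refl

  -- In the second tree layers 1 and 2 are attached at the column of s₀.
  bonus : Vec Bool n → ℕ
  bonus x = if does (x ≟ᵛ s₀) then 0 else suc (rank zero s₀)

  bonus-s₀ : bonus s₀ ≡ 0
  bonus-s₀ with s₀ ≟ᵛ s₀
  ... | yes _  = refl
  ... | no s≢s = contradiction refl s≢s

  bonus-≢ : ∀ {x} → x ≢ s₀ → bonus x ≡ suc (rank zero s₀)
  bonus-≢ {x} x≢s with x ≟ᵛ s₀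
  ... | yes x≡s = contradiction x≡s x≢s
  ... | no _    = refl

  bonus-≤ : ∀ x → bonus x ≤ suc (rank zero s₀)
  bonus-≤ x with x ≟ᵛ s₀
  ... | yes _ = z≤n
  ... | no _  = ≤-refl

  -- Outside `s₀` the bonus is already maximal, so it cannot rise along an arc leaving `x`.
  rank+bonus-< : ∀ {x y} → x ≢ s₀ → rank zero y < rank zero x →
                 rank zero y + bonus y < rank zero x + bonus x
  rank+bonus-< {x} {y} x≢s y<x =
    +-mono-<-≤ y<x (subst (bonus y ≤_) (sym (bonus-≢ x≢s)) (bonus-≤ y))

  -- The second tree uses the old matching arc from `r₀` to `s₀` in layers 1 and 2, where the old
  -- rank alone need not drop.
  mate<root-bonus : rank zero s₀ + bonus s₀ < rank zero r₀ + bonus r₀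
  mate<root-bonus rewrite bonus-s₀ | bonus-≢ (root≢mate zero zero)
    | +-identityʳ (rank zero s₀) = m≤n+m (suc (rank zero s₀)) (rank zero r₀)

  -- The constants count layers along C₄ from the layer of the root: in order 0, 1, 2, 3 for the
  -- first tree and 3, 0, 1, 2 for the others. Hence each C₄ arc that a tree uses lowers the rank.
  rank′ : Fin (2 + m) → Vec Bool (2 + n) → ℕ
  rank′ zero          (false ∷ false ∷ x) = rank zero x
  rank′ zero          (false ∷ true  ∷ x) = 1 + rank zero x
  rank′ zero          (true  ∷ true  ∷ x) = 2 + rank zero x
  rank′ zero          (true  ∷ false ∷ x) = 3 + (rank zero x + leafBonus x)
  rank′ (suc zero)    (true  ∷ false ∷ x) = rank zero x
  rank′ (suc zero)    (false ∷ false ∷ x) = 1 + rank zero x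
  rank′ (suc zero)    (false ∷ true  ∷ x) = 2 + (rank zero x + bonus x)
  rank′ (suc zero)    (true  ∷ true  ∷ x) = 3 + (rank zero x + bonus x)
  rank′ (suc (suc i)) (true  ∷ false ∷ x) = rank (suc i) x
  rank′ (suc (suc i)) (false ∷ false ∷ x) = 1 + rank (suc i) x
  rank′ (suc (suc i)) (false ∷ true  ∷ x) = 2 + rank (suc i) x
  rank′ (suc (suc i)) (true  ∷ true  ∷ x) = 3 + rank (suc i) x

  s₀≢r₀ : s₀ ≢ r₀
  s₀≢r₀ eq = root≢mate zero zero (sym eq)

  rootₛ≢r₀ : ∀ {i} → root (suc i) ≢ r₀
  rootₛ≢r₀ eq with () ← root-injective eq

  -- Layer 0 is a copy of the old tree. In layers 1 and 2 a vertex follows `p zero` or drops one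
  -- layer, and above `r₀` it always drops. Layer 3 hangs on layer 2.
  descends₀ : ∀ x → x ≢ root′ zero → rank′ zero (p′ zero x) < rank′ zero x
  descends₀ (true ∷ false ∷ x) _ with kind x
  ... | isRoot _     = s≤s (s≤s (s≤s (m≤m+n _ _)))
  ... | isMate _     = s≤s (s≤s (s≤s (m≤m+n _ _)))
  ... | special _ _  = s≤s (s≤s (s≤s (m≤m+n _ _)))
  ... | normal _ _ _ = s≤s (s≤s (s≤s (m≤m+n _ _)))
  descends₀ (true ∷ true ∷ x) _ with kind x
  ... | isRoot _       = ≤-refl
  ... | isMate refl    = s≤s (s≤s (descends zero s₀≢r₀))
  ... | special _ refl = s≤s (s≤s (descends zero rootₛ≢r₀))
  ... | normal x≢r _ _ = s≤s (s≤s (descends zero x≢r))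
  descends₀ (false ∷ true ∷ x) _ with kind x
  ... | isRoot _       = ≤-refl
  ... | isMate refl    = s≤s (descends zero s₀≢r₀)
  ... | special _ refl = s≤s (descends zero rootₛ≢r₀)
  ... | normal x≢r _ _ = ≤-refl
  descends₀ (false ∷ false ∷ x) x≢r′ with kind x
  ... | isRoot refl    = contradiction refl x≢r′
  ... | isMate refl    = descends zero s₀≢r₀
  ... | special _ refl = descends zero rootₛ≢r₀
  ... | normal x≢r _ _ = descends zero x≢r

  -- Layer 3 is a copy of the old tree. Layer 1 drains towards `s₀` and drops there to layer 0.
  -- Above `root (suc i)`, layers 0 to 2 use the arc to its mate, since the C₄ arc is given away;
  -- `mate<root` makes this a descent.
  descends₁ : ∀ x → x ≢ root′ (suc zero) →
              rank′ (suc zero) (p′ (suc zero) x) < rank′ (suc zero) x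
  descends₁ (true ∷ false ∷ x) x≢r′ with kind x
  ... | isRoot refl    = contradiction refl x≢r′
  ... | isMate refl    = descends zero s₀≢r₀
  ... | special _ refl = descends zero rootₛ≢r₀
  ... | normal x≢r _ _ = descends zero x≢r
  descends₁ (false ∷ false ∷ x) _ with kind x
  ... | isRoot _       = ≤-refl
  ... | isMate _       = ≤-refl
  ... | special i refl = s≤s (mate<root i)
  ... | normal _ _ _   = ≤-refl
  descends₁ (false ∷ true ∷ x) _ with kind x
  ... | isRoot refl      = s≤s (s≤s mate<root-bonus)
  ... | isMate _         = s≤s (s≤s (m≤m+n _ _))
  ... | special i refl   = s≤s (s≤s (rank+bonus-< (root≢mate (suc i) zero) (mate<root i)))
  ... | normal x≢r x≢s _ = s≤s (s≤s (rank+bonus-< x≢s (descends zero x≢r)))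
  descends₁ (true ∷ true ∷ x) _ with kind x
  ... | isRoot refl      = s≤s (s≤s (s≤s mate<root-bonus))
  ... | isMate _         = ≤-refl
  ... | special i refl   = s≤s (s≤s (s≤s (rank+bonus-< (root≢mate (suc i) zero) (mate<root i))))
  ... | normal x≢r x≢s _ = ≤-refl

  -- Each layer carries a copy of the old tree of `p (suc i)`; above `root (suc i)` the C₄ path from
  -- layer 2 through 1 and 0 to 3 joins the four copies.
  descendsₛ : ∀ i x → x ≢ root′ (suc (suc i)) →
              rank′ (suc (suc i)) (p′ (suc (suc i)) x) < rank′ (suc (suc i)) x
  descendsₛ i (true ∷ false ∷ x) x≢r′ with kind x
  ... | isRoot _     = descends (suc i) (λ { refl → x≢r′ refl })
  ... | isMate _     = descends (suc i) (λ { refl → x≢r′ refl })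
  ... | special _ _  = descends (suc i) (λ { refl → x≢r′ refl })
  ... | normal _ _ _ = descends (suc i) (λ { refl → x≢r′ refl })
  descendsₛ i (false ∷ false ∷ x) _ with kind x
  ... | isRoot refl = s≤s (descends (suc i) (rootₛ≢r₀ ∘ sym))
  ... | isMate refl = s≤s (descends (suc i) (root≢mate (suc i) zero ∘ sym))
  ... | normal _ _ x≢ = s≤s (descends (suc i) (x≢ i))
  ... | special j refl with i Fin.≟ j
  ...   | yes _  = ≤-refl
  ...   | no i≢j = s≤s (descends (suc i) (i≢j ∘ sym ∘ Fin.suc-injective ∘ root-injective))
  descendsₛ i (false ∷ true ∷ x) _ with kind x
  ... | isRoot refl = s≤s (s≤s (descends (suc i) (rootₛ≢r₀ ∘ sym)))
  ... | isMate refl = s≤s (s≤s (descends (suc i) (root≢mate (suc i) zero ∘ sym)))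
  ... | normal _ _ x≢ = s≤s (s≤s (descends (suc i) (x≢ i)))
  ... | special j refl with i Fin.≟ j
  ...   | yes _  = ≤-refl
  ...   | no i≢j = s≤s (s≤s (descends (suc i) (i≢j ∘ sym ∘ Fin.suc-injective ∘ root-injective)))
  descendsₛ i (true ∷ true ∷ x) _ with kind x
  ... | isRoot refl = s≤s (s≤s (s≤s (descends (suc i) (rootₛ≢r₀ ∘ sym))))
  ... | isMate refl = s≤s (s≤s (s≤s (descends (suc i) (root≢mate (suc i) zero ∘ sym))))
  ... | normal _ _ x≢ = s≤s (s≤s (s≤s (descends (suc i) (x≢ i))))
  ... | special j refl with i Fin.≟ j
  ...   | yes _  = ≤-refl
  ...   | no i≢j = s≤s (s≤s (s≤s (descends (suc i) (i≢j ∘ sym ∘ Fin.suc-injective ∘ root-injective))))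

  -- Away from `r₀` the first rank on layer 3 is the old one shifted by 3, so the old condition
  -- carries over; at `r₀` it comes from `leafBonus`.
  mate′<root′ : ∀ i → rank′ zero (at L3 (mate i)) < rank′ zero (at L3 (root i))
  mate′<root′ zero rewrite leafBonus-r₀ | leafBonus-≢ s₀≢r₀ | +-identityʳ (rank zero s₀) =
    s≤s (s≤s (s≤s (m≤n+m _ (rank zero r₀))))
  mate′<root′ (suc i)
    rewrite leafBonus-≢ (rootₛ≢r₀ {i}) | leafBonus-≢ (root≢mate zero (suc i) ∘ sym)
          | +-identityʳ (rank zero (mate (suc i))) | +-identityʳ (rank zero (root (suc i))) =
    s≤s (s≤s (s≤s (mate<root i)))

  step : Decomposition (2 + n) (suc m)
  step = record
    { p              = p′
    ; isOrientation  = permuteArcs-isOrientation permAt (boxArcs-isOrientation isOrientation)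
    ; root           = root′
    ; rank           = rank′
    ; descends       = λ { zero {x} → descends₀ x
                         ; (suc zero) {x} → descends₁ x
                         ; (suc (suc i)) {x} → descendsₛ i x }
    ; root-injective = λ eq → let l≡m , x≡y = at-injective eq in
        old-injective l≡m (root-injective x≡y)
    ; mate-injective = λ {i} {j} eq →
        let l≡m , x≡y = at-injective (trans (sym (p′-root′ i)) (trans eq (p′-root′ j))) in
        old-injective l≡m (mate-injective x≡y)
    ; root≢mate      = λ i j eq →
        root≢mate (old i) (old j) (proj₂ (at-injective (trans eq (p′-root′ j))))
    ; mate<root      = λ i → subst (λ x → rank′ zero x < rank′ zero (root′ (suc i)))
        (sym (p′-root′ (suc i))) (mate′<root′ i)
    }

-- From orientations to trees and a matching

DecomposesInto : ℕ → ℕ → Set₁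
DecomposesInto n k =
  Σ[ T ∈ (Fin k → Graph (Vec Bool n)) ]
  Σ[ M ∈ Graph (Vec Bool n) ]
    ((i : Fin k) → IsSpanningTree (Q n) (T i)) ×
    IsMatching (Q n) M ×
    HasEdgeCount M k ×
    IsEdgePartition (Q n) [ T , (λ (_ : ⊤) → M) ]

module FromDecomposition {n m} (D : Decomposition n m) where
  open Decomposition D
  open IsOrientation isOrientation

  arc⇒Q : ∀ {i x y} → p i x ≡ y → Adj (Q n) x y
  arc⇒Q refl = ~⇒Q (sound _ _)

  arc⇒Qˢ : ∀ {i x y} → p i x ≡ y → Adj (Q n) y x
  arc⇒Qˢ {i} {x} {y} eq = symm (Q n) {x} {y} (arc⇒Q eq)

  module Tree (i : Fin (suc m)) =
    ParentMap _≟ᵛ_ (p i) (root i) (rank i) (descends i)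

  T : Fin (suc m) → Graph (Vec Bool n)
  T = Tree.tree

  Joins : Fin (suc m) → Vec Bool n → Vec Bool n → Set
  Joins i x y = x ≡ root i × mate i ≡ y

  M : Graph (Vec Bool n)
  M = record
    { Adj    = λ x y → ∃[ i ] (Joins i x y ⊎ Joins i y x)
    ; symm   = λ { (i , inj₁ j) → i , inj₂ j ; (i , inj₂ j) → i , inj₁ j }
    ; irrefl = λ { refl (i , inj₁ (refl , eq)) → root≢mate i i (sym eq)
                 ; refl (i , inj₂ (refl , eq)) → root≢mate i i (sym eq) }
    }

  T⊆Q : ∀ i → T i ⊆ₑ Q n
  T⊆Q i (inj₁ (_ , eq)) = arc⇒Q eq
  T⊆Q i (inj₂ (_ , eq)) = arc⇒Qˢ eq

  M⊆Q : M ⊆ₑ Q n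
  M⊆Q (i , inj₁ (refl , eq)) = arc⇒Q eq
  M⊆Q (i , inj₂ (refl , eq)) = arc⇒Qˢ eq

  TT-disjoint : ∀ {i j} → i ≢ j → EdgeDisjoint (T i) (T j)
  TT-disjoint i≢j (inj₁ (_ , refl) , inj₁ (_ , eq)) = i≢j (inj (sym eq))
  TT-disjoint i≢j (inj₁ (_ , refl) , inj₂ (_ , eq)) = anti eq
  TT-disjoint i≢j (inj₂ (_ , refl) , inj₁ (_ , eq)) = anti eq
  TT-disjoint i≢j (inj₂ (_ , refl) , inj₂ (_ , eq)) = i≢j (inj (sym eq))

  -- A common edge is either one arc, whose tail would be the root that `T i` omits, or a pair of
  -- opposite arcs, against `anti`.
  TM-disjoint : ∀ i → EdgeDisjoint (T i) M
  TM-disjoint i (inj₁ (x≢r , refl) , _ , inj₁ (refl , eq)) = x≢r (cong root (inj eq))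
  TM-disjoint i (inj₁ (_ , refl) , j , inj₂ (y≡r , eq)) = anti (trans (cong (p j) y≡r) eq)
  TM-disjoint i (inj₂ (_ , refl) , j , inj₁ (x≡r , eq)) = anti (trans (cong (p j) x≡r) eq)
  TM-disjoint i (inj₂ (x≢r , refl) , _ , inj₂ (refl , eq)) = x≢r (cong root (inj eq))

  covered : ∀ {x y} → x ~ y →
            ∃[ i ] Adj ([_,_] {C = λ _ → Graph (Vec Bool n)} T (λ (_ : ⊤) → M) i) x y
  covered {x} {y} x~y with cover x~y
  ... | i , inj₁ eq with x ≟ᵛ root i
  ...   | yes x≡r = inj₂ tt , i , inj₁ (x≡r , trans (cong (p i) (sym x≡r)) eq)
  ...   | no x≢r  = inj₁ i , inj₁ (x≢r , eq)
  covered {x} {y} x~y | i , inj₂ eq with y ≟ᵛ root i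
  ...   | yes y≡r = inj₂ tt , i , inj₂ (y≡r , trans (cong (p i) (sym y≡r)) eq)
  ...   | no y≢r  = inj₁ i , inj₂ (y≢r , eq)

  partition : IsEdgePartition (Q n) [ T , (λ (_ : ⊤) → M) ]
  partition =
    (λ { (inj₁ i) → T⊆Q i ; (inj₂ _) → M⊆Q }) ,
    (λ { (inj₁ i) (inj₁ j) i≢j → TT-disjoint (i≢j ∘ cong inj₁)
       ; (inj₁ i) (inj₂ _) _ → TM-disjoint i
       ; (inj₂ _) (inj₁ j) _ (a , b) → TM-disjoint j (b , a)
       ; (inj₂ _) (inj₂ _) i≢j → contradiction refl i≢j }) ,
    λ {x} {y} xy → covered (Q⇒~ {x = x} {y} xy)

  rootEdge : Fin (suc m) → Edge M
  rootEdge i = edge (root i , mate i) (i , inj₁ (refl , refl))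

  label : Edge M → Fin (suc m)
  label e = proj₁ (adj e)

  ≈ₑ-rootEdge : ∀ e → rootEdge (label e) ≈ₑ e
  ≈ₑ-rootEdge (edge _ (i , inj₁ (refl , refl))) = inj₁ refl
  ≈ₑ-rootEdge (edge _ (i , inj₂ (refl , refl))) = inj₂ refl

  -- Both edges are equivalent to the root edge of their common label.
  label-cong : ∀ e f → label e ≡ label f → e ≈ₑ f
  label-cong e f eq =
    Setoid.trans (edgeSetoid M) {e} {rootEdge (label e)} {f}
      (Setoid.sym (edgeSetoid M) {rootEdge (label e)} {e} (≈ₑ-rootEdge e))
      (subst (λ i → rootEdge i ≈ₑ f) (sym eq) (≈ₑ-rootEdge f))

  endpoint : ∀ {x} e → x ∈ₑ e → x ≡ root (label e) ⊎ x ≡ mate (label e)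
  endpoint (edge _ (i , inj₁ (refl , refl))) x∈e = x∈e
  endpoint (edge _ (i , inj₂ (refl , refl))) (inj₁ eq) = inj₂ eq
  endpoint (edge _ (i , inj₂ (refl , refl))) (inj₂ eq) = inj₁ eq

  -- All roots and mates are distinct vertices, so a vertex determines the label of its matching
  -- edge.
  shared-endpoint : ∀ {x i j} → x ≡ root i ⊎ x ≡ mate i → x ≡ root j ⊎ x ≡ mate j → i ≡ j
  shared-endpoint (inj₁ refl) (inj₁ eq) = root-injective eq
  shared-endpoint (inj₂ refl) (inj₂ eq) = mate-injective eq
  shared-endpoint (inj₁ refl) (inj₂ eq) = contradiction eq (root≢mate _ _)
  shared-endpoint (inj₂ refl) (inj₁ eq) = contradiction (sym eq) (root≢mate _ _)

  isMatching : IsMatching (Q n) M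
  isMatching = M⊆Q , λ e f e≉f x (x∈e , x∈f) →
    e≉f (label-cong e f (shared-endpoint (endpoint e x∈e) (endpoint f x∈f)))

  edgeCount : HasEdgeCount M (suc m)
  edgeCount = record
    { to        = rootEdge
    ; cong      = λ { refl → inj₁ refl }
    ; bijective =
        (λ { (inj₁ eq) → root-injective (cong proj₁ eq)
           ; (inj₂ eq) → contradiction (cong proj₁ eq) (root≢mate _ _) }) ,
        λ e → label e , λ { refl → ≈ₑ-rootEdge e }
    }

  decomposes : DecomposesInto n (suc m)
  decomposes = T , M , (λ i → T⊆Q i , Tree.isTree i) , isMatching , edgeCount , partition

-- The induction and the theorem

decomposition : ∀ m → Decomposition (2 * suc m) m
decomposition zero    = square
decomposition (suc m) =
  -- The two dimensions are equal, but not definitionally.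
  subst (λ n → Decomposition n (suc m)) (sym (*-suc 2 (suc m))) (Step.step (decomposition m))

mainTheorem3 : (k : ℕ) → k ≥ 1 →
    Σ[ T ∈ (Fin k → Graph (Vec Bool (2 * k))) ]
    Σ[ M ∈ Graph (Vec Bool (2 * k)) ]
    ((i : Fin k) → IsSpanningTree (Q (2 * k)) (T i)) ×
    IsMatching (Q (2 * k)) M ×
    HasEdgeCount M k ×
    IsEdgePartition (Q (2 * k)) [ T , (λ (_ : ⊤) → M) ]
mainTheorem3 (suc m) _ = FromDecomposition.decomposes (decomposition m)
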